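{- In the type theory described in the context, if there exists an integer type $(\mathbb{Z}, Z, S)$, then there exists a natural number type, i.e. an initial natural number algebra.
   Context: Setting: We work in a dependent type theory without universes, having: identity types $x =_A y$ (Martin-Löf style, no axiom K, no equality reflection); a unit type $\mathbf{1}$; dependent sums $\Sigma$ and dependent products $\Pi$ with judgmental $\beta$- and $\eta$-laws, and function extensionality; a two-element type $\mathbf{2}$ with elements $0,1$ satisfying its universal property (for every type $C$ and $d_0,d_1 : C$, the type of $f : \mathbf{2}\to C$ with $f(0)=d_0$ and $f(1)=d_1$ is contractible); and descent for $\mathbf{2}$: for any types $A_0, A_1$ there is a type family $C$ over $\mathbf{2}$ with equivalences $C(0)\simeq A_0$ and $C(1)\simeq A_1$. Equivalences, contractibility, propositions, embeddings and fibers are meant in the sense of homotopy type theory. From this one obtains the empty type $\mathbf{0}$, binary and finite coproducts $A_0\sqcup\cdots\sqcup A_{k-1}$ with coprojections $\tau_i$ (disjoint embeddings) and copairing $[f_0,\dots]$, satisfying descent. Definitions: A natural number algebra is a type $A$ with $z : A$ and $s : A \to A$; its structure map is $[z,s] : \mathbf{1}\sqcup A \to A$. A morphism of natural number algebras $A\to B$ is a function $f : A\to B$ with identifications $f(z)=z$ and $f(s(a)) = s(f(a))$ for all $a:A$. A natural number algebra $A$ is initial (a natural number type) if for every natural number algebra $B$ the type of morphisms $A\to B$ is contractible. An integer algebra is a natural number algebra whose $s$ is an equivalence; morphisms of integer algebras are morphisms of the underlying natural number algebras. An integer type is an integer algebra $(\mathbb{Z}, Z, S)$ such that for every integer algebra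 $B$ the type of morphisms $\mathbb{Z}\to B$ is contractible. -}

module Defs where

open import Level using (Level; _⊔_; suc)
open import Data.Product using (Σ)
open import Data.Unit.Polymorphic using (⊤)
open import Relation.Binary.PropositionalEquality using (_≡_)

-- The object type theory is presented as in two-level type theory: Agda is the
-- outer level, and the types of the theory are those Agda types that carry an
-- (abstract) `IsType` structure.  Agda's own ≡ plays the role of judgmental
-- equality; the identity type `Id` of the theory is unrelated to it.
-- Type families over A are outer functions Tm A → Ty, i.e. types in a context
-- extended by a variable of type A.  There is no universe: Ty is not a Ty.

record Type {ℓ ℓ′} (IsType : Set ℓ → Set ℓ′) : Set (suc ℓ ⊔ ℓ′) where
  constructor type
  field
    Tm     : Set ℓ
    isType : IsType Tm

-- 𝟏, Σ and Π are interpreted by Agda's own, so that their β- and η-laws hold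
-- definitionally.  Only the closure properties listed here are assumed of
-- `IsType`; in particular neither ℕ nor Bool, ⊥, _⊎_ or _≡_ is assumed to be
-- a type of the theory.

record CoreTheory (ℓ ℓ′ : Level) : Set (suc (ℓ ⊔ ℓ′)) where
  field
    IsType : Set ℓ → Set ℓ′

  Ty : Set (suc ℓ ⊔ ℓ′)
  Ty = Type IsType

  open Type public using (Tm)

  field
    𝟏-isType : IsType ⊤
    Σ-isType : (A : Ty) (B : Tm A → Ty) → IsType (Σ (Tm A) (λ a → Tm (B a)))
    Π-isType : (A : Ty) (B : Tm A → Ty) → IsType ((a : Tm A) → Tm (B a))

    Id   : (A : Ty) → Tm A → Tm A → Ty
    refl : (A : Ty) (a : Tm A) → Tm (Id A a a)
    J    : (A : Ty) (a : Tm A) (C : (x : Tm A) → Tm (Id A a x) → Ty) →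
           Tm (C a (refl A a)) → (x : Tm A) (p : Tm (Id A a x)) → Tm (C x p)
    J-β  : (A : Ty) (a : Tm A) (C : (x : Tm A) → Tm (Id A a x) → Ty)
           (c : Tm (C a (refl A a))) → J A a C c a (refl A a) ≡ c

module HoTT {ℓ ℓ′} (T : CoreTheory ℓ ℓ′) where
  open CoreTheory T public

  infixr 4 _⇒_
  infixr 5 _⊗_
  infix  3 _≃_

  𝟏 : Ty
  𝟏 = type ⊤ 𝟏-isType

  ∑ : (A : Ty) → (Tm A → Ty) → Ty
  ∑ A B = type (Σ (Tm A) (λ a → Tm (B a))) (Σ-isType A B)

  ∏ : (A : Ty) → (Tm A → Ty) → Ty
  ∏ A B = type ((a : Tm A) → Tm (B a)) (Π-isType A B)

  _⊗_ : Ty → Ty → Ty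
  A ⊗ B = ∑ A (λ _ → B)

  _⇒_ : Ty → Ty → Ty
  A ⇒ B = ∏ A (λ _ → B)

  isContr : Ty → Ty
  isContr A = ∑ A (λ c → ∏ A (λ x → Id A c x))

  fiber : (A B : Ty) → Tm (A ⇒ B) → Tm B → Ty
  fiber A B f b = ∑ A (λ a → Id B (f a) b)

  isEquiv : (A B : Ty) → Tm (A ⇒ B) → Ty
  isEquiv A B f = ∏ B (λ b → isContr (fiber A B f b))

  _≃_ : Ty → Ty → Ty
  A ≃ B = ∑ (A ⇒ B) (isEquiv A B)

  Homotopy : (A : Ty) (B : Tm A → Ty) → Tm (∏ A B) → Tm (∏ A B) → Ty
  Homotopy A B f g = ∏ A (λ a → Id (B a) (f a) (g a))

  happly : (A : Ty) (B : Tm A → Ty) (f g : Tm (∏ A B)) →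
           Tm (Id (∏ A B) f g ⇒ Homotopy A B f g)
  happly A B f g = J (∏ A B) f (λ h _ → Homotopy A B f h) (λ a → refl (B a) (f a)) g

record TypeTheory (ℓ ℓ′ : Level) : Set (suc (ℓ ⊔ ℓ′)) where
  field
    core : CoreTheory ℓ ℓ′

  open HoTT core public

  field
    funext : (A : Ty) (B : Tm A → Ty) (f g : Tm (∏ A B)) →
             Tm (isEquiv (Id (∏ A B) f g) (Homotopy A B f g) (happly A B f g))

    𝟐     : Ty
    𝟎₂ 𝟏₂ : Tm 𝟐
    -- Only non-dependent elimination, and computation only up to Id.
    𝟐-universal : (C : Ty) (d₀ d₁ : Tm C) →
      Tm (isContr (∑ (𝟐 ⇒ C) (λ f → Id C (f 𝟎₂) d₀ ⊗ Id C (f 𝟏₂) d₁)))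

    descent   : (A₀ A₁ : Ty) → Tm 𝟐 → Ty
    descent-0 : (A₀ A₁ : Ty) → Tm (descent A₀ A₁ 𝟎₂ ≃ A₀)
    descent-1 : (A₀ A₁ : Ty) → Tm (descent A₀ A₁ 𝟏₂ ≃ A₁)

module Algebras {ℓ ℓ′} (T : TypeTheory ℓ ℓ′) where
  open TypeTheory T

  record NatAlgebra : Set (suc ℓ ⊔ ℓ′) where
    field
      Carrier : Ty
      z       : Tm Carrier
      s       : Tm (Carrier ⇒ Carrier)

  Morphism : NatAlgebra → NatAlgebra → Ty
  Morphism A B =
    ∑ (A.Carrier ⇒ B.Carrier) (λ f →
      Id B.Carrier (f A.z) B.z ⊗
      ∏ A.Carrier (λ a → Id B.Carrier (f (A.s a)) (B.s (f a))))
    where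
      module A = NatAlgebra A
      module B = NatAlgebra B

  record IntAlgebra : Set (suc ℓ ⊔ ℓ′) where
    field
      natAlgebra : NatAlgebra
    open NatAlgebra natAlgebra public
    field
      s-isEquiv : Tm (isEquiv Carrier Carrier s)

  open IntAlgebra using (natAlgebra)

  -- With no universe, "for every algebra B" is a quantification at the outer level.

  record NaturalNumberType : Set (suc ℓ ⊔ ℓ′) where
    field
      algebra : NatAlgebra
      initial : (B : NatAlgebra) → Tm (isContr (Morphism algebra B))

  record IntegerType : Set (suc ℓ ⊔ ℓ′) where
    field
      algebra : IntAlgebra
      initial : (B : IntAlgebra) →
                Tm (isContr (Morphism (natAlgebra algebra) (natAlgebra B)))

open Algebras public using (NaturalNumberType; IntegerType)

-- The odometer on ℤ × 𝟐 identifies ℤ with two copies of itself.  This makes possible a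
-- Hilbert's-hotel automorphism g of a left and a right copy of ℤ which maps the right
-- copy R properly into itself.  The orbit of a point b ∉ R with g b ∈ R assigns a sign to
-- every integer.  Let M be the integers n with gⁿ b ∈ R; an element of M is either the
-- successor of one, or a member of the set W of crossings into R.
--
-- For m in M and any integer n, let m ≺ n mean g⁻ⁿ (gᵐ b) ∉ R.  A recursively specified
-- function on { m | m ≺ n } is a fixed point of "extend to n + 1, then restrict to n".
-- The other composite, "restrict, then extend", is the corresponding operator for n + 1,
-- so the fixed points for n and n + 1 are equivalent by the rolling rule.  For n = 0 the
-- domain is empty, so by induction over ℤ the solution is unique for every n.
-- Hence M is freely generated by W under successor, and the natural numbers are the
-- elements of M generated by a single crossing w₀.
module Submission where

open import Level using (Level; _⊔_) renaming (suc to lsuc)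
open import Data.Product using (_,_; proj₁; proj₂; Σ; _×_)
open import Data.Unit.Polymorphic using (tt)
open import Function using (_∘_; id)
open import Relation.Binary.PropositionalEquality using (_≡_; subst) renaming (refl to ≡-refl; sym to ≡-sym)
open import Defs

-- Paths, propositions, contractibility and equivalences.

module Basics {ℓ ℓ′} (T : TypeTheory ℓ ℓ′) where
  open TypeTheory T

  ≡⇒Id : {A : Ty} {a b : Tm A} → a ≡ b → Tm (Id A a b)
  ≡⇒Id ≡-refl = refl _ _

  transport : {A : Ty} (B : Tm A → Ty) {a b : Tm A} → Tm (Id A a b) → Tm (B a) → Tm (B b)
  transport {A} B {a} {b} p x = J A a (λ y _ → B y) x b p

  transport-refl : {A : Ty} (B : Tm A → Ty) {a : Tm A} (x : Tm (B a)) →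
                   Tm (Id (B a) (transport B (refl A a) x) x)
  transport-refl {A} B {a} x = ≡⇒Id (J-β A a (λ y _ → B y) x)

  sym : {A : Ty} {a b : Tm A} → Tm (Id A a b) → Tm (Id A b a)
  sym {A} {a} p = transport (λ y → Id A y a) p (refl A a)

  trans : {A : Ty} {a b c : Tm A} → Tm (Id A a b) → Tm (Id A b c) → Tm (Id A a c)
  trans {A} {a} p q = transport (λ y → Id A a y) q p

  infixr 5 _∙_
  _∙_ = trans

  ap : {A B : Ty} (f : Tm A → Tm B) {a b : Tm A} → Tm (Id A a b) → Tm (Id B (f a) (f b))
  ap {A} {B} f {a} p = transport (λ y → Id B (f a) (f y)) p (refl B (f a))

  ap-refl : {A B : Ty} (f : Tm A → Tm B) (a : Tm A) →
            Tm (Id (Id B (f a) (f a)) (ap {A} {B} f (refl A a)) (refl B (f a)))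
  ap-refl {A} {B} f a = transport-refl (λ y → Id B (f a) (f y)) (refl B (f a))

  trans-reflʳ : {A : Ty} {a b : Tm A} (p : Tm (Id A a b)) → Tm (Id (Id A a b) (p ∙ refl A b) p)
  trans-reflʳ {A} {a} {b} p = transport-refl (λ y → Id A a y) p

  trans-reflˡ : {A : Ty} {a b : Tm A} (p : Tm (Id A a b)) → Tm (Id (Id A a b) (refl A a ∙ p) p)
  trans-reflˡ {A} {a} {b} p =
    J A a (λ y q → Id (Id A a y) (refl A a ∙ q) q) (trans-reflʳ (refl A a)) b p

  trans-symˡ : {A : Ty} {a b : Tm A} (p : Tm (Id A a b)) → Tm (Id (Id A b b) (sym p ∙ p) (refl A b))
  trans-symˡ {A} {a} {b} p =
    J A a (λ y q → Id (Id A y y) (sym q ∙ q) (refl A y))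
      (trans-reflʳ (sym (refl A a)) ∙ transport-refl (λ y → Id A y a) (refl A a)) b p

  trans-sym-cancelˡ : {A : Ty} {a b c : Tm A} (p : Tm (Id A a b)) (q : Tm (Id A a c)) →
                      Tm (Id (Id A a c) (p ∙ (sym p ∙ q)) q)
  trans-sym-cancelˡ {A} {a} {b} {c} p q =
    J A a (λ y r → Id (Id A a c) (r ∙ (sym r ∙ q)) q)
      (trans-reflˡ (sym (refl A a) ∙ q)
        ∙ (ap {Id A a a} {Id A a c} (λ r → r ∙ q) (transport-refl (λ y → Id A y a) (refl A a))
        ∙ trans-reflˡ q)) b p

  trans-sym-cancelʳ : {A : Ty} {a b c : Tm A} (p : Tm (Id A a b)) (q : Tm (Id A c b)) →
                      Tm (Id (Id A a b) ((p ∙ sym q) ∙ q) p)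
  trans-sym-cancelʳ {A} {a} {b} {c} p q =
    J A c (λ y r → ∏ (Id A a y) (λ s → Id (Id A a y) ((s ∙ sym r) ∙ r) s))
      (λ s → trans-reflʳ (s ∙ sym (refl A c))
           ∙ (ap {Id A c c} {Id A a c} (λ r → s ∙ r) (transport-refl (λ y → Id A y c) (refl A c))
           ∙ trans-reflʳ s)) b q p

  trans-cancelʳ-sym : {A : Ty} {a b c : Tm A} (p : Tm (Id A a b)) (q : Tm (Id A b c)) →
                      Tm (Id (Id A a b) ((p ∙ q) ∙ sym q) p)
  trans-cancelʳ-sym {A} {a} {b} {c} p q =
    J A b (λ y r → Id (Id A a b) ((p ∙ r) ∙ sym r) p)
      (ap {Id A b b} {Id A a b} (λ r → (p ∙ refl A b) ∙ r) (transport-refl (λ y → Id A y b) (refl A b))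
        ∙ (trans-reflʳ (p ∙ refl A b) ∙ trans-reflʳ p)) c q

  apply : {A : Ty} (B : Tm A → Ty) {f g : Tm (∏ A B)} → Tm (Id (∏ A B) f g) →
          (a : Tm A) → Tm (Id (B a) (f a) (g a))
  apply {A} B p a = ap {∏ A B} {B a} (λ h → h a) p

  apply′ : {A B : Ty} {f g : Tm (A ⇒ B)} → Tm (Id (A ⇒ B) f g) →
           (a : Tm A) → Tm (Id B (f a) (g a))
  apply′ {A} {B} = apply (λ _ → B)

  funext′ : {A : Ty} (B : Tm A → Ty) {f g : Tm (∏ A B)} →
            ((a : Tm A) → Tm (Id (B a) (f a) (g a))) → Tm (Id (∏ A B) f g)
  funext′ {A} B {f} {g} α = proj₁ (proj₁ (funext A B f g α))

  ∑-path : {A : Ty} (B : Tm A → Ty) {a a′ : Tm A} {b : Tm (B a)} {b′ : Tm (B a′)}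
           (p : Tm (Id A a a′)) → Tm (Id (B a′) (transport B p b) b′) →
           Tm (Id (∑ A B) (a , b) (a′ , b′))
  ∑-path {A} B {a} {a′} {b} {b′} p q =
    J A a (λ x r → ∏ (B x) (λ y → Id (B x) (transport B r b) y ⇒ Id (∑ A B) (a , b) (x , y)))
      (λ y s → ap {B a} {∑ A B} (λ y → a , y) (sym (transport-refl B b) ∙ s))
      a′ p b′ q

  pair-path : {A B : Ty} {a a′ : Tm A} {b b′ : Tm B} →
              Tm (Id A a a′) → Tm (Id B b b′) → Tm (Id (A ⊗ B) (a , b) (a′ , b′))
  pair-path {A} {B} {a} {a′} {b} {b′} p q =
    ap {A} {A ⊗ B} (λ x → x , b) p ∙ ap {B} {A ⊗ B} (λ y → a′ , y) q

  isProp : Ty → Ty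
  isProp A = ∏ A (λ x → ∏ A (λ y → Id A x y))

  isContr⇒isProp : (A : Ty) → Tm (isContr A) → Tm (isProp A)
  isContr⇒isProp A (c , h) x y = sym (h x) ∙ h y

  -- `J` shows that every path from `x` equals one built from `h` and its endpoints alone, so
  -- parallel paths agree.
  isProp⇒isSet : (A : Ty) → Tm (isProp A) → (x y : Tm A) → Tm (isProp (Id A x y))
  isProp⇒isSet A h x y p q = sym (canonical y p) ∙ canonical y q
    where
    canonical : (z : Tm A) (r : Tm (Id A x z)) → Tm (Id (Id A x z) (sym (h x x) ∙ h x z) r)
    canonical z r =
      J A x (λ w s → Id (Id A x w) (sym (h x x) ∙ h x w) s) (trans-symˡ (h x x)) z r

  isProp-∏ : (A : Ty) (B : Tm A → Ty) → ((a : Tm A) → Tm (isProp (B a))) → Tm (isProp (∏ A B))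
  isProp-∏ A B h f g = funext′ B (λ a → h a (f a) (g a))

  ∑-path-prop : {A : Ty} (B : Tm A → Ty) → ((a : Tm A) → Tm (isProp (B a))) →
                {x y : Tm (∑ A B)} → Tm (Id A (proj₁ x) (proj₁ y)) → Tm (Id (∑ A B) x y)
  ∑-path-prop B h {y = y} p = ∑-path B p (h (proj₁ y) _ (proj₂ y))

  isProp-isContr : (A : Ty) → Tm (isProp (isContr A))
  isProp-isContr A (c , h) (c′ , h′) =
    ∑-path-prop (λ a → ∏ A (Id A a))
      (λ a → isProp-∏ A (Id A a) (isProp⇒isSet A (isContr⇒isProp A (c , h)) a)) (h c′)

  isContr-retract : (A B : Ty) (r : Tm A → Tm B) (s : Tm B → Tm A) →
                    ((b : Tm B) → Tm (Id B (r (s b)) b)) → Tm (isContr A) → Tm (isContr B)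
  isContr-retract A B r s rs (c , h) = r c , λ b → ap {A} {B} r (h (s b)) ∙ rs b

  isContr-singleton : (A : Ty) (a : Tm A) → Tm (isContr (∑ A (Id A a)))
  isContr-singleton A a =
    (a , refl A a) , λ (x , p) → J A a (λ y q → Id (∑ A (Id A a)) (a , refl A a) (y , q))
                                      (refl (∑ A (Id A a)) (a , refl A a)) x p

  -- The path from `a` to `x` is routed through the centre; when `x` is `a` it cancels to `refl`,
  -- which gives the computation rule.
  isContr-ind : (A : Ty) → Tm (isContr A) → (a : Tm A) (Y : Tm A → Ty) (y : Tm (Y a)) →
                Σ ((x : Tm A) → Tm (Y x)) λ h → Tm (Id (Y a) (h a) y)
  isContr-ind A (c , h) a Y y =
    (λ x → transport Y (sym (h a) ∙ h x) y) ,
    ap {Id A a a} {Y a} (λ p → transport Y p y) (trans-symˡ (h a)) ∙ transport-refl Y y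

  -- The value at `b` comes from the centre of its fiber. Over `f a` that centre is identified with
  -- `(a , refl)`, hence the computation rule.
  isEquiv-ind : (A B : Ty) (f : Tm A → Tm B) → Tm (isEquiv A B f) → (Y : Tm B → Ty)
                (y : (a : Tm A) → Tm (Y (f a))) →
                Σ ((b : Tm B) → Tm (Y b)) λ h → (a : Tm A) → Tm (Id (Y (f a)) (h (f a)) (y a))
  isEquiv-ind A B f e Y y =
    (λ b → value (proj₁ (e b))) ,
    λ a → ap {fiber A B f (f a)} {Y (f a)} value (proj₂ (e (f a)) (a , refl B (f a)))
        ∙ transport-refl Y (y a)
    where
    value : {b : Tm B} → Tm (fiber A B f b) → Tm (Y b)
    value (a , p) = transport Y p (y a)

  isContr-singletonˡ : (A : Ty) (a : Tm A) → Tm (isContr (∑ A (λ x → Id A x a)))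
  isContr-singletonˡ A a =
    (a , refl A a) , λ (x , p) →
      J A x (λ y q → Id (∑ A (λ z → Id A z y)) (y , refl A y) (x , q))
        (refl (∑ A (λ z → Id A z x)) (x , refl A x)) a p

  -- Using ap f (η a) rather than ε (f a) exhibits fiber f b as a retract of
  -- fiber (f ∘ g) b without any coherence between η and ε.
  quasi-inverse⇒isEquiv : (A B : Ty) (f : Tm A → Tm B) (g : Tm B → Tm A) →
    ((a : Tm A) → Tm (Id A (g (f a)) a)) → ((b : Tm B) → Tm (Id B (f (g b)) b)) →
    Tm (isEquiv A B f)
  quasi-inverse⇒isEquiv A B f g η ε b =
    isContr-retract (fiber B B (λ x → f (g x)) b) (fiber A B f b)
      (λ (x , q) → g x , q)
      (λ (a , p) → f a , ap {A} {B} f (η a) ∙ p)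
      (λ (a , p) → move (η a) p)
      (isContr-retract (∑ B (λ x → Id B x b)) (fiber B B (λ x → f (g x)) b)
        (λ (x , q) → x , ε x ∙ q)
        (λ (x , q) → x , sym (ε x) ∙ q)
        (λ (x , q) → ap {Id B (f (g x)) b} {fiber B B (λ x → f (g x)) b} (λ r → x , r)
                       (trans-sym-cancelˡ (ε x) q))
        (isContr-singletonˡ B b))
    where
    move : {a a′ : Tm A} (h : Tm (Id A a′ a)) (p : Tm (Id B (f a) b)) →
           Tm (Id (fiber A B f b) (a′ , ap {A} {B} f h ∙ p) (a , p))
    move {a} {a′} h p =
      J A a′ (λ x k → ∏ (Id B (f x) b) (λ q →
               Id (fiber A B f b) (a′ , ap {A} {B} f k ∙ q) (x , q)))
        (λ q → ap {Id B (f a′) b} {fiber A B f b} (λ r → a′ , r)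
                 (ap {Id B (f a′) (f a′)} {Id B (f a′) b} (λ r → r ∙ q) (ap-refl {A} {B} f a′)
                  ∙ trans-reflˡ q))
        a h p

  isEquiv-transʳ : {A : Ty} {a b c : Tm A} (q : Tm (Id A b c)) →
                   Tm (isEquiv (Id A a b) (Id A a c) (λ p → p ∙ q))
  isEquiv-transʳ {A} {a} {b} {c} q =
    quasi-inverse⇒isEquiv (Id A a b) (Id A a c) (λ p → p ∙ q) (λ p → p ∙ sym q)
      (λ p → trans-cancelʳ-sym p q) (λ p → trans-sym-cancelʳ p q)

  homotopy-ind : (A : Ty) (B : Tm A → Ty) (f : Tm (∏ A B))
                 (Y : (g : Tm (∏ A B)) → Tm (Homotopy A B f g) → Ty) →
                 Tm (Y f (λ a → refl (B a) (f a))) →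
                 (g : Tm (∏ A B)) (α : Tm (Homotopy A B f g)) → Tm (Y g α)
  homotopy-ind A B f Y y g =
    proj₁ (isEquiv-ind (Id (∏ A B) f g) (Homotopy A B f g) (happly A B f g) (funext A B f g) (Y g)
      (J (∏ A B) f (λ k p → Y k (happly A B f k p))
        -- `J-β` is a judgmental equation, so the base case is moved along it by the outer `subst`.
        (subst (λ α → Tm (Y f α))
          (≡-sym (J-β (∏ A B) f (λ h _ → Homotopy A B f h) (λ a → refl (B a) (f a)))) y) g))

  -- Fixed points and the rolling rule.

  Fix : (A : Ty) → (Tm A → Tm A) → Ty
  Fix A k = ∑ A (λ a → Id A (k a) a)

  isContr-Fix-cong : (A : Ty) (k k′ : Tm A → Tm A) → ((a : Tm A) → Tm (Id A (k′ a) (k a))) →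
                     Tm (isContr (Fix A k)) → Tm (isContr (Fix A k′))
  isContr-Fix-cong A k k′ H =
    isContr-retract (Fix A k) (Fix A k′)
      (λ (a , p) → a , H a ∙ p)
      (λ (a , p) → a , sym (H a) ∙ p)
      (λ (a , p) → ap {Id A (k′ a) a} {Fix A k′} (λ q → a , q) (trans-sym-cancelˡ (H a) p))

  -- `r` carries fixed points of `s ∘ r` to fixed points of `r ∘ s`, and `s` carries them back. The
  -- round trip from `b` to `r (s b)` is undone by the fixed-point path `q` itself, so the target is
  -- a retract of the source.
  isContr-Fix-roll : (A B : Ty) (r : Tm A → Tm B) (s : Tm B → Tm A) →
                     Tm (isContr (Fix A (s ∘ r))) → Tm (isContr (Fix B (r ∘ s)))
  isContr-Fix-roll A B r s =
    isContr-retract (Fix A (s ∘ r)) (Fix B (r ∘ s))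
      (λ (a , p) → r a , ap {A} {B} r p)
      (λ (b , q) → s b , ap {B} {A} s q)
      (λ (b , q) →
        ap {Id B (r (s (r (s b)))) (r (s b))} {Fix B (r ∘ s)} (λ e → r (s b) , e)
          (sym (trans-reflʳ (ap {A} {B} r (ap {B} {A} s q))))
        ∙ (move q (refl B (r (s b)))
        ∙ ap {Id B (r (s b)) b} {Fix B (r ∘ s)} (λ e → b , e) (trans-reflˡ q)))
    where
    -- J applies because the endpoints of p are independent; the case needed is q = refl.
    move : {c x : Tm B} (p : Tm (Id B c x)) (q : Tm (Id B (r (s x)) c)) →
           Tm (Id (Fix B (r ∘ s)) (c , ap {A} {B} r (ap {B} {A} s p) ∙ q) (x , q ∙ p))
    move {c} {x} p q =
      J B c (λ y p′ → ∏ (Id B (r (s y)) c) (λ q′ →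
               Id (Fix B (r ∘ s)) (c , ap {A} {B} r (ap {B} {A} s p′) ∙ q′) (y , q′ ∙ p′)))
        (λ q′ → ap {Id B (r (s c)) c} {Fix B (r ∘ s)} (λ e → c , e)
          ((ap {Id B (r (s c)) (r (s c))} {Id B (r (s c)) c} (λ e → e ∙ q′)
             (ap {Id A (s c) (s c)} {Id B (r (s c)) (r (s c))} (ap {A} {B} r) (ap-refl {B} {A} s c)
               ∙ ap-refl {A} {B} r (s c))
             ∙ trans-reflˡ q′)
           ∙ sym (trans-reflʳ q′)))
        x p q

-- The empty type, induction on `𝟐`, and a decidable predicate.

module TwoElements {ℓ ℓ′} (T : TypeTheory ℓ ℓ′) where
  open TypeTheory T
  open Basics T

  𝟎 : Ty
  𝟎 = Id 𝟐 𝟎₂ 𝟏₂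

  -- Descent supplies a family with `𝟏` over `𝟎₂` and `A` over `𝟏₂`; a path between the two elements
  -- transports the point of `𝟏` into `A`.
  𝟎-elim : (A : Ty) → Tm 𝟎 → Tm A
  𝟎-elim A p =
    proj₁ (descent-1 𝟏 A) (transport (descent 𝟏 A) p (proj₁ (proj₁ (proj₂ (descent-0 𝟏 A) tt))))

  ¬_ : Ty → Ty
  ¬ A = A ⇒ 𝟎

  infix 6 ¬_

  isProp-¬ : (A : Ty) → Tm (isProp (¬ A))
  isProp-¬ A = isProp-∏ A (λ _ → 𝟎) (λ _ x y → 𝟎-elim (Id 𝟎 x y) x)

  𝟐-rec : (C : Ty) → Tm C → Tm C → Tm 𝟐 → Tm C
  𝟐-rec C c₀ c₁ = proj₁ (proj₁ (𝟐-universal C c₀ c₁))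

  𝟐-rec-0 : (C : Ty) (c₀ c₁ : Tm C) → Tm (Id C (𝟐-rec C c₀ c₁ 𝟎₂) c₀)
  𝟐-rec-0 C c₀ c₁ = proj₁ (proj₂ (proj₁ (𝟐-universal C c₀ c₁)))

  𝟐-rec-1 : (C : Ty) (c₀ c₁ : Tm C) → Tm (Id C (𝟐-rec C c₀ c₁ 𝟏₂) c₁)
  𝟐-rec-1 C c₀ c₁ = proj₂ (proj₂ (proj₁ (𝟐-universal C c₀ c₁)))

  -- The universal property gives a map into the total space. Its first projection is an endomap of
  -- `𝟐` fixing both elements, hence the identity by uniqueness.
  𝟐-ind : (C : Tm 𝟐 → Ty) → Tm (C 𝟎₂) → Tm (C 𝟏₂) → (i : Tm 𝟐) → Tm (C i)
  𝟐-ind C c₀ c₁ i = transport C (apply′ {𝟐} {𝟐} (ap {Endo} {𝟐 ⇒ 𝟐} proj₁ section≡id) i) (proj₂ (h i))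
    where
    Endo : Ty
    Endo = ∑ (𝟐 ⇒ 𝟐) (λ f → Id 𝟐 (f 𝟎₂) 𝟎₂ ⊗ Id 𝟐 (f 𝟏₂) 𝟏₂)

    h : Tm 𝟐 → Tm (∑ 𝟐 C)
    h = 𝟐-rec (∑ 𝟐 C) (𝟎₂ , c₀) (𝟏₂ , c₁)

    section≡id : Tm (Id Endo
      ((λ j → proj₁ (h j)) ,
        ap {∑ 𝟐 C} {𝟐} proj₁ (𝟐-rec-0 (∑ 𝟐 C) (𝟎₂ , c₀) (𝟏₂ , c₁)) ,
        ap {∑ 𝟐 C} {𝟐} proj₁ (𝟐-rec-1 (∑ 𝟐 C) (𝟎₂ , c₀) (𝟏₂ , c₁)))
      ((λ j → j) , refl 𝟐 𝟎₂ , refl 𝟐 𝟏₂))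
    section≡id = isContr⇒isProp Endo (𝟐-universal 𝟐 𝟎₂ 𝟏₂) _ _

  IsOne : Tm 𝟐 → Ty
  IsOne = descent 𝟎 𝟏

  isOne-1 : Tm (IsOne 𝟏₂)
  isOne-1 = proj₁ (proj₁ (proj₂ (descent-1 𝟎 𝟏) tt))

  ¬isOne-0 : Tm (¬ IsOne 𝟎₂)
  ¬isOne-0 = proj₁ (descent-0 𝟎 𝟏)

  isProp-IsOne : (i : Tm 𝟐) → Tm (isProp (IsOne i))
  isProp-IsOne = 𝟐-ind (λ i → isProp (IsOne i))
    (λ x y → 𝟎-elim (Id (IsOne 𝟎₂) x y) (¬isOne-0 x))
    -- By η for `𝟏`, every element lies in the fiber over `tt` via `refl`, and this fiber is
    -- contractible.
    (λ x y → ap {fiber (IsOne 𝟏₂) 𝟏 (proj₁ (descent-1 𝟎 𝟏)) tt} {IsOne 𝟏₂} proj₁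
      (isContr⇒isProp (fiber (IsOne 𝟏₂) 𝟏 (proj₁ (descent-1 𝟎 𝟏)) tt) (proj₂ (descent-1 𝟎 𝟏) tt)
        (x , refl 𝟏 tt) (y , refl 𝟏 tt)))

  -- Decidability in Church-encoded form: an eliminator into an arbitrary `C` in place of an element
  -- of a coproduct.
  IsOne-cases : (i : Tm 𝟐) (C : Ty) → (Tm (IsOne i) → Tm C) → (Tm (¬ IsOne i) → Tm C) → Tm C
  IsOne-cases i C =
    𝟐-ind (λ i → (IsOne i ⇒ C) ⇒ (¬ IsOne i ⇒ C) ⇒ C) (λ _ g → g ¬isOne-0) (λ f _ → f isOne-1) i

-- From dependent elimination to initiality.

module Initiality {ℓ ℓ′} (T : TypeTheory ℓ ℓ′) where
  open TypeTheory T
  open Algebras T hiding (NaturalNumberType; IntegerType)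
  open Basics T

  Induction : NatAlgebra → Set (lsuc ℓ ⊔ ℓ′)
  Induction A = (Y : Tm Carrier → Ty) (y₀ : Tm (Y z)) (t : (n : Tm Carrier) → Tm (Y n) → Tm (Y (s n))) →
    Σ ((n : Tm Carrier) → Tm (Y n)) λ h →
      Tm (Id (Y z) (h z) y₀) × ((n : Tm Carrier) → Tm (Id (Y (s n)) (h (s n)) (t n (h n))))
    where open NatAlgebra A

  module _ (A B : NatAlgebra) where
    open NatAlgebra A using () renaming (Carrier to ℕ; z to zero; s to suc)
    open NatAlgebra B using (z; s) renaming (Carrier to X)

    Compatible : (f k : Tm (Morphism A B)) → ((n : Tm ℕ) → Tm (Id X (proj₁ f n) (proj₁ k n))) → Ty
    Compatible (f , f-z , f-s) (k , k-z , k-s) α =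
      Id (Id X (f zero) z) (α zero ∙ k-z) f-z
      ⊗ ∏ ℕ (λ n → Id (Id X (f (suc n)) (s (k n))) (α (suc n) ∙ k-s n) (f-s n ∙ ap {X} {X} s (α n)))

    -- By `homotopy-ind` only the constant homotopy has to be treated; there `Compatible` says, up
    -- to unit laws, that the two morphisms have equal laws.
    morphism-path : (f k : Tm (Morphism A B)) (α : (n : Tm ℕ) → Tm (Id X (proj₁ f n) (proj₁ k n))) →
                    Tm (Compatible f k α) → Tm (Id (Morphism A B) f k)
    morphism-path 𝕗@(f , f-z , f-s) (k , k-z , k-s) α c =
      homotopy-ind ℕ (λ _ → X) f
        (λ k α → ∏ (Laws k) (λ e → Compatible 𝕗 (k , e) α ⇒ Id (Morphism A B) 𝕗 (k , e)))
        (λ (e-z , e-s) (c-z , c-s) →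
          ap {Laws f} {Morphism A B} (λ e → f , e)
            (pair-path {Id X (f zero) z} {∏ ℕ (λ n → Id X (f (suc n)) (s (f n)))}
              (sym c-z ∙ trans-reflˡ e-z)
              (funext′ (λ n → Id X (f (suc n)) (s (f n))) (λ n →
                sym (trans-reflʳ (f-s n))
                ∙ ap {Id X (s (f n)) (s (f n))} {Id X (f (suc n)) (s (f n))} (λ p → f-s n ∙ p)
                    (sym (ap-refl {X} {X} s (f n)))
                ∙ sym (c-s n)
                ∙ trans-reflˡ (e-s n)))))
        k α (k-z , k-s) c
      where
      Laws : Tm (ℕ ⇒ X) → Ty
      Laws k = Id X (k zero) z ⊗ ∏ ℕ (λ n → Id X (k (suc n)) (s (k n)))

    induction⇒isContr-Morphism : Induction A → Tm (isContr (Morphism A B))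
    induction⇒isContr-Morphism ind = ind (λ _ → X) z (λ _ → s) , unique (ind (λ _ → X) z (λ _ → s))
      where
      unique : (f k : Tm (Morphism A B)) → Tm (Id (Morphism A B) f k)
      unique 𝕗@(f , f-z , f-s) 𝕜@(k , k-z , k-s) = morphism-path 𝕗 𝕜 (proj₁ α)
        ( (ap {Id X (f zero) (k zero)} {Id X (f zero) z} (λ p → p ∙ k-z) (proj₁ (proj₂ α))
            ∙ trans-sym-cancelʳ f-z k-z)
        , λ n → ap {Id X (f (suc n)) (k (suc n))} {Id X (f (suc n)) (s (k n))} (λ p → p ∙ k-s n)
                  (proj₂ (proj₂ α) n)
              ∙ trans-sym-cancelʳ (f-s n ∙ ap {X} {X} s (proj₁ α n)) (k-s n))
        where
        -- The laws of `k` enter inverted at the end, so that composing with `k-z` and `k-s` in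
        -- `Compatible` cancels them.
        α = ind (λ n → Id X (f n) (k n)) (f-z ∙ sym k-z)
              (λ n p → (f-s n ∙ ap {X} {X} s p) ∙ sym (k-s n))

-- Orbits of automorphisms, and induction over `ℤ` for propositions.

module Integers {ℓ ℓ′} (T : TypeTheory ℓ ℓ′) (𝕫 : IntegerType T) where
  open TypeTheory T
  open Algebras T hiding (NaturalNumberType; IntegerType)
  open Basics T
  open IntegerType 𝕫 using (initial)
  open IntAlgebra (IntegerType.algebra 𝕫) public using ()
    renaming (Carrier to ℤ; z to 0ℤ; s to S; s-isEquiv to S-isEquiv)

  integerAlgebra : (B : Ty) → Tm B → (g g⁻¹ : Tm B → Tm B) →
    ((b : Tm B) → Tm (Id B (g⁻¹ (g b)) b)) → ((b : Tm B) → Tm (Id B (g (g⁻¹ b)) b)) → IntAlgebra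
  integerAlgebra B b g g⁻¹ η ε = record
    { natAlgebra = record { Carrier = B ; z = b ; s = g }
    ; s-isEquiv  = quasi-inverse⇒isEquiv B B g g⁻¹ η ε
    }

  module Orbit (B : Ty) (b : Tm B) (g g⁻¹ : Tm B → Tm B)
    (η : (x : Tm B) → Tm (Id B (g⁻¹ (g x)) x)) (ε : (x : Tm B) → Tm (Id B (g (g⁻¹ x)) x)) where

    private
      contr = initial (integerAlgebra B b g g⁻¹ η ε)

    abstract
      orbit : Tm ℤ → Tm B
      orbit = proj₁ (proj₁ contr)

      orbit-0 : Tm (Id B (orbit 0ℤ) b)
      orbit-0 = proj₁ (proj₂ (proj₁ contr))

      orbit-S : (n : Tm ℤ) → Tm (Id B (orbit (S n)) (g (orbit n)))
      orbit-S = proj₂ (proj₂ (proj₁ contr))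

      orbit-unique : (h : Tm ℤ → Tm B) → Tm (Id B (h 0ℤ) b) →
        ((n : Tm ℤ) → Tm (Id B (h (S n)) (g (h n)))) → (n : Tm ℤ) → Tm (Id B (orbit n) (h n))
      orbit-unique h h-0 h-S = apply′ {ℤ} {B} (ap {Mor} {ℤ ⇒ B} proj₁ (proj₂ contr (h , h-0 , h-S)))
        where
        Mor : Ty
        Mor = ∑ (ℤ ⇒ B) (λ f → Id B (f 0ℤ) b ⊗ ∏ ℤ (λ n → Id B (f (S n)) (g (f n))))

  P : Tm ℤ → Tm ℤ
  P n = proj₁ (proj₁ (S-isEquiv n))

  S-P : (n : Tm ℤ) → Tm (Id ℤ (S (P n)) n)
  S-P n = proj₂ (proj₁ (S-isEquiv n))

  P-S : (n : Tm ℤ) → Tm (Id ℤ (P (S n)) n)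
  P-S n = ap {fiber ℤ ℤ S (S n)} {ℤ} proj₁ (proj₂ (S-isEquiv (S n)) (n , refl ℤ (S n)))

  module Identity = Orbit ℤ 0ℤ S P P-S S-P

  -- Both `h` and `id` satisfy the equations of the orbit of `0ℤ` under `S`, which is unique.
  endomorphism-id : (h : Tm ℤ → Tm ℤ) → Tm (Id ℤ (h 0ℤ) 0ℤ) → ((n : Tm ℤ) → Tm (Id ℤ (h (S n)) (S (h n)))) →
          (n : Tm ℤ) → Tm (Id ℤ (h n) n)
  endomorphism-id h h-0 h-S n =
    sym (Identity.orbit-unique h h-0 h-S n) ∙ Identity.orbit-unique id (refl ℤ 0ℤ) (λ n → refl ℤ (S n)) n

  -- As `Q` is propositional, `up` and `down` lift `S` and `P` to mutually inverse maps of the total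
  -- space. The orbit there projects to an endomorphism of `ℤ`, hence to the identity.
  ℤ-ind-prop : (Q : Tm ℤ → Ty) → ((n : Tm ℤ) → Tm (isProp (Q n))) → Tm (Q 0ℤ) →
    ((n : Tm ℤ) → Tm (Q n) → Tm (Q (S n))) → ((n : Tm ℤ) → Tm (Q (S n)) → Tm (Q n)) →
    (n : Tm ℤ) → Tm (Q n)
  ℤ-ind-prop Q Q-prop q up down n =
    transport Q (endomorphism-id (λ n → proj₁ (orbit n)) (ap {∑ ℤ Q} {ℤ} proj₁ orbit-0)
                  (λ n → ap {∑ ℤ Q} {ℤ} proj₁ (orbit-S n)) n)
      (proj₂ (orbit n))
    where
    open Orbit (∑ ℤ Q) (0ℤ , q)
      (λ (n , x) → S n , up n x)
      (λ (n , x) → P n , down (P n) (transport Q (sym (S-P n)) x))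
      (λ (n , _) → ∑-path-prop Q Q-prop (P-S n))
      (λ (n , _) → ∑-path-prop Q Q-prop (S-P n))

-- Division by two and the Hilbert's-hotel automorphism.

module Hotel {ℓ ℓ′} (T : TypeTheory ℓ ℓ′) (𝕫 : IntegerType T) where
  open TypeTheory T
  open Basics T
  open TwoElements T
  open Integers T 𝕫

  ℤ² : Ty
  ℤ² = ℤ ⊗ 𝟐

  module Doubling where
    open Orbit ℤ 0ℤ (S ∘ S) (P ∘ P)
      (λ n → ap {ℤ} {ℤ} P (P-S (S n)) ∙ P-S n)
      (λ n → ap {ℤ} {ℤ} S (S-P (P n)) ∙ S-P n)
      public renaming (orbit to double; orbit-0 to double-0; orbit-S to double-S)

  open Doubling using (double; double-0; double-S)

  -- This is 2n + i.
  join : Tm ℤ² → Tm ℤ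
  join (n , i) = 𝟐-rec ℤ (double n) (S (double n)) i

  join-0 : (n : Tm ℤ) → Tm (Id ℤ (join (n , 𝟎₂)) (double n))
  join-0 n = 𝟐-rec-0 ℤ (double n) (S (double n))

  join-1 : (n : Tm ℤ) → Tm (Id ℤ (join (n , 𝟏₂)) (S (double n)))
  join-1 n = 𝟐-rec-1 ℤ (double n) (S (double n))

  -- Successor and predecessor of 2n + i in terms of its digits: `i` flips, with a carry into or a
  -- borrow from `n`.
  odometer odometer⁻¹ : Tm ℤ² → Tm ℤ²
  odometer   (n , i) = 𝟐-rec ℤ² (n , 𝟏₂) (S n , 𝟎₂) i
  odometer⁻¹ (n , i) = 𝟐-rec ℤ² (P n , 𝟏₂) (n , 𝟎₂) i

  odometer-0 : (n : Tm ℤ) → Tm (Id ℤ² (odometer (n , 𝟎₂)) (n , 𝟏₂))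
  odometer-0 n = 𝟐-rec-0 ℤ² (n , 𝟏₂) (S n , 𝟎₂)

  odometer-1 : (n : Tm ℤ) → Tm (Id ℤ² (odometer (n , 𝟏₂)) (S n , 𝟎₂))
  odometer-1 n = 𝟐-rec-1 ℤ² (n , 𝟏₂) (S n , 𝟎₂)

  odometer⁻¹-0 : (n : Tm ℤ) → Tm (Id ℤ² (odometer⁻¹ (n , 𝟎₂)) (P n , 𝟏₂))
  odometer⁻¹-0 n = 𝟐-rec-0 ℤ² (P n , 𝟏₂) (n , 𝟎₂)

  odometer⁻¹-1 : (n : Tm ℤ) → Tm (Id ℤ² (odometer⁻¹ (n , 𝟏₂)) (n , 𝟎₂))
  odometer⁻¹-1 n = 𝟐-rec-1 ℤ² (P n , 𝟏₂) (n , 𝟎₂)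

  odometer-η : (x : Tm ℤ²) → Tm (Id ℤ² (odometer⁻¹ (odometer x)) x)
  odometer-η (n , i) =
    𝟐-ind (λ i → Id ℤ² (odometer⁻¹ (odometer (n , i))) (n , i))
      (ap {ℤ²} {ℤ²} odometer⁻¹ (odometer-0 n) ∙ odometer⁻¹-1 n)
      (ap {ℤ²} {ℤ²} odometer⁻¹ (odometer-1 n) ∙ odometer⁻¹-0 (S n)
        ∙ ap {ℤ} {ℤ²} (λ m → m , 𝟏₂) (P-S n)) i

  odometer-ε : (x : Tm ℤ²) → Tm (Id ℤ² (odometer (odometer⁻¹ x)) x)
  odometer-ε (n , i) =
    𝟐-ind (λ i → Id ℤ² (odometer (odometer⁻¹ (n , i))) (n , i))
      (ap {ℤ²} {ℤ²} odometer (odometer⁻¹-0 n) ∙ odometer-1 (P n)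
        ∙ ap {ℤ} {ℤ²} (λ m → m , 𝟎₂) (S-P n))
      (ap {ℤ²} {ℤ²} odometer (odometer⁻¹-1 n) ∙ odometer-0 n) i

  -- Counting from zero with the odometer yields division by two with remainder.
  module Splitting = Orbit ℤ² (0ℤ , 𝟎₂) odometer odometer⁻¹ odometer-η odometer-ε
  open Splitting using () renaming (orbit to split; orbit-0 to split-0; orbit-S to split-S)

  join-odometer : (x : Tm ℤ²) → Tm (Id ℤ (join (odometer x)) (S (join x)))
  join-odometer (n , i) =
    𝟐-ind (λ i → Id ℤ (join (odometer (n , i))) (S (join (n , i))))
      (ap {ℤ²} {ℤ} join (odometer-0 n) ∙ join-1 n ∙ ap {ℤ} {ℤ} S (sym (join-0 n)))
      (ap {ℤ²} {ℤ} join (odometer-1 n) ∙ join-0 (S n) ∙ double-S n ∙ ap {ℤ} {ℤ} S (sym (join-1 n))) i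

  join-split : (n : Tm ℤ) → Tm (Id ℤ (join (split n)) n)
  join-split = endomorphism-id (join ∘ split)
    (ap {ℤ²} {ℤ} join split-0 ∙ join-0 0ℤ ∙ double-0)
    (λ n → ap {ℤ²} {ℤ} join (split-S n) ∙ join-odometer (split n))

  -- As functions of `n`, both sides are orbits of `(0ℤ , 𝟎₂)` under two turns of the odometer.
  split-double : (n : Tm ℤ) → Tm (Id ℤ² (split (double n)) (n , 𝟎₂))
  split-double n =
    sym (orbit-unique (split ∘ double)
          (ap {ℤ} {ℤ²} split double-0 ∙ split-0)
          (λ n → ap {ℤ} {ℤ²} split (double-S n) ∙ split-S (S (double n))
               ∙ ap {ℤ²} {ℤ²} odometer (split-S (double n))) n)
    ∙ orbit-unique (λ n → n , 𝟎₂) (refl ℤ² (0ℤ , 𝟎₂))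
        (λ n → sym (ap {ℤ²} {ℤ²} odometer (odometer-0 n) ∙ odometer-1 n)) n
    where
    open Orbit ℤ² (0ℤ , 𝟎₂) (odometer ∘ odometer) (odometer⁻¹ ∘ odometer⁻¹)
      (λ x → ap {ℤ²} {ℤ²} odometer⁻¹ (odometer-η (odometer x)) ∙ odometer-η x)
      (λ x → ap {ℤ²} {ℤ²} odometer (odometer-ε (odometer⁻¹ x)) ∙ odometer-ε x)

  split-join : (x : Tm ℤ²) → Tm (Id ℤ² (split (join x)) x)
  split-join (n , i) =
    𝟐-ind (λ i → Id ℤ² (split (join (n , i))) (n , i))
      (ap {ℤ} {ℤ²} split (join-0 n) ∙ split-double n)
      (ap {ℤ} {ℤ²} split (join-1 n) ∙ split-S (double n)
        ∙ ap {ℤ²} {ℤ²} odometer (split-double n) ∙ odometer-0 n) i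

  -- Hilbert's hotel: the tag 𝟎₂ marks the left copy of ℤ, the tag 𝟏₂ the right one;
  -- even numbers are halved on the left and produced by doubling on the right, and
  -- odd numbers cross over from left to right.
  leave enter hotel hotel⁻¹ : Tm ℤ² → Tm ℤ²
  leave   (n , i) = 𝟐-rec ℤ² (n , 𝟎₂) (join (n , 𝟏₂) , 𝟏₂) i
  enter   (n , i) = 𝟐-rec ℤ² (n , 𝟏₂) (join (n , 𝟏₂) , 𝟎₂) i
  hotel   (x , i) = 𝟐-rec ℤ² (leave (split x)) (join (x , 𝟎₂) , 𝟏₂) i
  hotel⁻¹ (x , i) = 𝟐-rec ℤ² (join (x , 𝟎₂) , 𝟎₂) (enter (split x)) i

  hotel-0 : (x : Tm ℤ) → Tm (Id ℤ² (hotel (x , 𝟎₂)) (leave (split x)))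
  hotel-0 x = 𝟐-rec-0 ℤ² (leave (split x)) (join (x , 𝟎₂) , 𝟏₂)

  hotel-1 : (x : Tm ℤ) → Tm (Id ℤ² (hotel (x , 𝟏₂)) (join (x , 𝟎₂) , 𝟏₂))
  hotel-1 x = 𝟐-rec-1 ℤ² (leave (split x)) (join (x , 𝟎₂) , 𝟏₂)

  hotel⁻¹-0 : (x : Tm ℤ) → Tm (Id ℤ² (hotel⁻¹ (x , 𝟎₂)) (join (x , 𝟎₂) , 𝟎₂))
  hotel⁻¹-0 x = 𝟐-rec-0 ℤ² (join (x , 𝟎₂) , 𝟎₂) (enter (split x))

  hotel⁻¹-1 : (x : Tm ℤ) → Tm (Id ℤ² (hotel⁻¹ (x , 𝟏₂)) (enter (split x)))
  hotel⁻¹-1 x = 𝟐-rec-1 ℤ² (join (x , 𝟎₂) , 𝟎₂) (enter (split x))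

  leave-0 : (n : Tm ℤ) → Tm (Id ℤ² (leave (n , 𝟎₂)) (n , 𝟎₂))
  leave-0 n = 𝟐-rec-0 ℤ² (n , 𝟎₂) (join (n , 𝟏₂) , 𝟏₂)

  leave-1 : (n : Tm ℤ) → Tm (Id ℤ² (leave (n , 𝟏₂)) (join (n , 𝟏₂) , 𝟏₂))
  leave-1 n = 𝟐-rec-1 ℤ² (n , 𝟎₂) (join (n , 𝟏₂) , 𝟏₂)

  enter-0 : (n : Tm ℤ) → Tm (Id ℤ² (enter (n , 𝟎₂)) (n , 𝟏₂))
  enter-0 n = 𝟐-rec-0 ℤ² (n , 𝟏₂) (join (n , 𝟏₂) , 𝟎₂)

  enter-1 : (n : Tm ℤ) → Tm (Id ℤ² (enter (n , 𝟏₂)) (join (n , 𝟏₂) , 𝟎₂))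
  enter-1 n = 𝟐-rec-1 ℤ² (n , 𝟏₂) (join (n , 𝟏₂) , 𝟎₂)

  hotel-join : (y : Tm ℤ²) → Tm (Id ℤ² (hotel (join y , 𝟎₂)) (leave y))
  hotel-join y = hotel-0 (join y) ∙ ap {ℤ²} {ℤ²} leave (split-join y)

  hotel⁻¹-join : (y : Tm ℤ²) → Tm (Id ℤ² (hotel⁻¹ (join y , 𝟏₂)) (enter y))
  hotel⁻¹-join y = hotel⁻¹-1 (join y) ∙ ap {ℤ²} {ℤ²} enter (split-join y)

  hotel⁻¹-leave : (y : Tm ℤ²) → Tm (Id ℤ² (hotel⁻¹ (leave y)) (join y , 𝟎₂))
  hotel⁻¹-leave (n , i) =
    𝟐-ind (λ i → Id ℤ² (hotel⁻¹ (leave (n , i))) (join (n , i) , 𝟎₂))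
      (ap {ℤ²} {ℤ²} hotel⁻¹ (leave-0 n) ∙ hotel⁻¹-0 n)
      (ap {ℤ²} {ℤ²} hotel⁻¹ (leave-1 n) ∙ hotel⁻¹-join (n , 𝟏₂) ∙ enter-1 n) i

  hotel-enter : (y : Tm ℤ²) → Tm (Id ℤ² (hotel (enter y)) (join y , 𝟏₂))
  hotel-enter (n , i) =
    𝟐-ind (λ i → Id ℤ² (hotel (enter (n , i))) (join (n , i) , 𝟏₂))
      (ap {ℤ²} {ℤ²} hotel (enter-0 n) ∙ hotel-1 n)
      (ap {ℤ²} {ℤ²} hotel (enter-1 n) ∙ hotel-join (n , 𝟏₂) ∙ leave-1 n) i

  hotel-η : (x : Tm ℤ²) → Tm (Id ℤ² (hotel⁻¹ (hotel x)) x)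
  hotel-η (x , i) =
    𝟐-ind (λ i → Id ℤ² (hotel⁻¹ (hotel (x , i))) (x , i))
      (ap {ℤ²} {ℤ²} hotel⁻¹ (hotel-0 x) ∙ hotel⁻¹-leave (split x)
        ∙ ap {ℤ} {ℤ²} (λ y → y , 𝟎₂) (join-split x))
      (ap {ℤ²} {ℤ²} hotel⁻¹ (hotel-1 x) ∙ hotel⁻¹-join (x , 𝟎₂) ∙ enter-0 x) i

  hotel-ε : (x : Tm ℤ²) → Tm (Id ℤ² (hotel (hotel⁻¹ x)) x)
  hotel-ε (x , i) =
    𝟐-ind (λ i → Id ℤ² (hotel (hotel⁻¹ (x , i))) (x , i))
      (ap {ℤ²} {ℤ²} hotel (hotel⁻¹-0 x) ∙ hotel-join (x , 𝟎₂) ∙ leave-0 x)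
      (ap {ℤ²} {ℤ²} hotel (hotel⁻¹-1 x) ∙ hotel-enter (split x)
        ∙ ap {ℤ} {ℤ²} (λ y → y , 𝟏₂) (join-split x)) i

  R : Tm ℤ² → Ty
  R (_ , i) = IsOne i

  hotel-R : (x : Tm ℤ²) → Tm (R x) → Tm (R (hotel x))
  hotel-R (x , i) =
    𝟐-ind (λ i → R (x , i) ⇒ R (hotel (x , i)))
      (λ e → 𝟎-elim (R (hotel (x , 𝟎₂))) (¬isOne-0 e))
      (λ e → transport R (sym (hotel-1 x)) isOne-1) i

  -- The number one in the left copy: being odd, it is moved to the right by `hotel`.
  gate : Tm ℤ²
  gate = join (0ℤ , 𝟏₂) , 𝟎₂

  hotel-gate-R : Tm (R (hotel gate))
  hotel-gate-R = transport R (sym (hotel-join (0ℤ , 𝟏₂) ∙ leave-1 0ℤ)) isOne-1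

-- The algebra of positions inside `R`, and the natural numbers in it.

module FreeAlgebra {ℓ ℓ′} (T : TypeTheory ℓ ℓ′) (𝕫 : IntegerType T) where
  open TypeTheory T
  open Algebras T hiding (NaturalNumberType; IntegerType)
  open Basics T
  open Initiality T
  open TwoElements T
  open Integers T 𝕫

  module Crossing (B : Ty) (g g⁻¹ : Tm B → Tm B)
    (η : (x : Tm B) → Tm (Id B (g⁻¹ (g x)) x)) (ε : (x : Tm B) → Tm (Id B (g (g⁻¹ x)) x))
    (R : Tm B → Ty) (isProp-R : (x : Tm B) → Tm (isProp (R x)))
    (R-cases : (x : Tm B) (C : Ty) → (Tm (R x) → Tm C) → (Tm (¬ R x) → Tm C) → Tm C)
    (g-R : (x : Tm B) → Tm (R x) → Tm (R (g x)))
    (b : Tm B) (b∉R : Tm (¬ R b)) (gb∈R : Tm (R (g b))) where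

    module Position = Orbit B b g g⁻¹ η ε
    open Position using () renaming (orbit to position; orbit-0 to position-0; orbit-S to position-S)

    -- The powers of `g⁻¹` are an orbit of `id` in the function type, under composition with `g⁻¹`,
    -- whose inverse is composition with `g`.
    module Rewind = Orbit (B ⇒ B) id (λ φ x → g⁻¹ (φ x)) (λ φ x → g (φ x))
      (λ φ → funext′ (λ _ → B) (λ x → ε (φ x)))
      (λ φ → funext′ (λ _ → B) (λ x → η (φ x)))

    rewind : Tm ℤ → Tm B → Tm B
    rewind = Rewind.orbit

    rewind-0 : (x : Tm B) → Tm (Id B (rewind 0ℤ x) x)
    rewind-0 = apply′ {B} {B} Rewind.orbit-0

    rewind-S : (n : Tm ℤ) (x : Tm B) → Tm (Id B (rewind (S n) x) (g⁻¹ (rewind n x)))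
    rewind-S n = apply′ {B} {B} (Rewind.orbit-S n)

    rewind-g : (n : Tm ℤ) (x : Tm B) → Tm (Id B (rewind n x) (rewind (S n) (g x)))
    rewind-g n = apply′ {B} {B} (Rewind.orbit-unique (λ n x → rewind (S n) (g x))
      (funext′ (λ _ → B) (λ x → rewind-S 0ℤ (g x)
        ∙ ap {B} {B} g⁻¹ (rewind-0 (g x)) ∙ η x))
      (λ n → funext′ (λ _ → B) (λ x → rewind-S (S n) (g x))) n)

    rewind-position-S : (n m : Tm ℤ) →
      Tm (Id B (rewind n (position m)) (rewind (S n) (position (S m))))
    rewind-position-S n m =
      rewind-g n (position m) ∙ ap {B} {B} (rewind (S n)) (sym (position-S m))

    -- The left side does not change under `S`, so it is an orbit of `b` under the identity map, and
    -- so is the constant function `b`.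
    rewind-position : (n : Tm ℤ) → Tm (Id B (rewind n (position n)) b)
    rewind-position n =
      sym (orbit-unique (λ n → rewind n (position n)) (rewind-0 (position 0ℤ) ∙ position-0)
            (λ n → sym (rewind-position-S n n)) n)
      ∙ orbit-unique (λ _ → b) (refl B b) (λ _ → refl B b) n
      where open Orbit B b id id (refl B) (refl B)

    M : Ty
    M = ∑ ℤ (λ n → R (position n))

    -- Nothing rules out crossings into R other than w₀ below.
    W : Ty
    W = ∑ ℤ (λ n → R (position (S n)) ⊗ ¬ R (position n))

    base : Tm W → Tm M
    base (n , u , _) = S n , u

    R-position-S : (n : Tm ℤ) → Tm (R (position n)) → Tm (R (position (S n)))
    R-position-S n u = transport R (sym (position-S n)) (g-R (position n) u)

    next : Tm M → Tm M
    next (n , u) = S n , R-position-S n u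

    w₀ : Tm W
    w₀ = 0ℤ
       , transport R (sym (position-S 0ℤ ∙ ap {B} {B} g position-0)) gb∈R
       , λ u → b∉R (transport R position-0 u)

    module Cases (Y : Tm M → Ty) (a : (w : Tm W) → Tm (Y (base w))) (c : (x : Tm M) → Tm (Y (next x))) where
      private
        -- The values are bundled with their computation rules, so that one use of the non-dependent
        -- `R-cases` delivers both.
        Branch : Tm ℤ → Ty
        Branch n = ∑ (∏ (R (position (S n))) (λ u → Y (S n , u))) (λ h →
          ∏ (R (position (S n))) (λ u → ∏ (¬ R (position n)) (λ v → Id (Y (S n , u)) (h u) (a (n , u , v))))
          ⊗ ∏ (R (position n)) (λ u → Id (Y (next (n , u))) (h (R-position-S n u)) (c (n , u))))

        branch : (n : Tm ℤ) → Tm (Branch n)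
        branch n = R-cases (position n) (Branch n) right left
          where
          right : Tm (R (position n)) → Tm (Branch n)
          right u₀ = proj₁ h
                   , (λ u v → 𝟎-elim (Id (Y (S n , u)) (proj₁ h u) (a (n , u , v))) (v u₀))
                   , (λ u → transport (λ u → Id (Y (next (n , u))) (proj₁ h (R-position-S n u)) (c (n , u)))
                              (isProp-R (position n) u₀ u) (proj₂ h))
            where
            -- Here `R (position (S n))` is an inhabited proposition, so the value at
            -- `R-position-S n u₀` determines all others.
            h = isContr-ind (R (position (S n)))
                  (R-position-S n u₀ , isProp-R (position (S n)) (R-position-S n u₀))
                  (R-position-S n u₀) (λ u → Y (S n , u)) (c (n , u₀))

          left : Tm (¬ R (position n)) → Tm (Branch n)
          left v₀ = (λ u → a (n , u , v₀))
                  , (λ u v → ap {¬ R (position n)} {Y (S n , u)} (λ v → a (n , u , v))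
                               (isProp-¬ (R (position n)) v₀ v))
                  , (λ u → 𝟎-elim (Id (Y (next (n , u))) (a (n , R-position-S n u , v₀)) (c (n , u))) (v₀ u))

        Values : Tm ℤ → Ty
        Values n = ∏ (R (position n)) (λ u → Y (n , u))

        values : Σ ((n : Tm ℤ) → Tm (Values n)) λ h →
                 (n : Tm ℤ) → Tm (Id (Values (S n)) (h (S n)) (proj₁ (branch n)))
        -- Every integer is a successor, so prescribing values at each `S n` covers all of `ℤ`.
        values = isEquiv-ind ℤ ℤ S S-isEquiv Values (λ n → proj₁ (branch n))

      cases : (x : Tm M) → Tm (Y x)
      cases (n , u) = proj₁ values n u

      cases-base : (w : Tm W) → Tm (Id (Y (base w)) (cases (base w)) (a w))
      cases-base (n , u , v) =
        apply (λ u → Y (S n , u)) (proj₂ values n) u ∙ proj₁ (proj₂ (branch n)) u v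

      cases-next : (x : Tm M) → Tm (Id (Y (next x)) (cases (next x)) (c x))
      cases-next (n , u) =
        apply (λ u → Y (S n , u)) (proj₂ values n) (R-position-S n u) ∙ proj₂ (proj₂ (branch n)) u

    infix 6 _≺_
    _≺_ : Tm M → Tm ℤ → Ty
    (m , _) ≺ n = ¬ R (rewind n (position m))

    ≺-prop : (x : Tm M) (n : Tm ℤ) → Tm (isProp (x ≺ n))
    ≺-prop (m , _) n = isProp-¬ (R (rewind n (position m)))

    ≺-0 : (x : Tm M) → Tm (¬ (x ≺ 0ℤ))
    ≺-0 (m , u) l = l (transport R (sym (rewind-0 (position m))) u)

    -- If `rewind (S n) (position m)` were in `R`, so would be its image under `g`, which is
    -- `rewind n (position m)`.
    ≺-weaken : (x : Tm M) (n : Tm ℤ) → Tm (x ≺ n) → Tm (x ≺ S n)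
    ≺-weaken (m , _) n l u =
      l (transport R (ap {B} {B} g (rewind-S n (position m)) ∙ ε (rewind n (position m)))
          (g-R (rewind (S n) (position m)) u))

    ≺-pred : (x : Tm M) (n : Tm ℤ) → Tm (next x ≺ S n) → Tm (x ≺ n)
    ≺-pred (m , _) n l u = l (transport R (rewind-position-S n m) u)

    -- Rewinding `position m` by `m` steps gives `b`, which is outside `R`. Hence each element
    -- belongs to the stage of its own index.
    ≺-self : (x : Tm M) → Tm (x ≺ proj₁ x)
    ≺-self (m , _) u = b∉R (transport R (rewind-position m) u)

    -- Induction on `M` from unique solutions at every stage.

    module M-Induction (Y : Tm M → Ty) (a : (w : Tm W) → Tm (Y (base w)))
      (t : (x : Tm M) → Tm (Y x) → Tm (Y (next x))) where

      Partial : Tm ℤ → Ty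
      Partial n = ∏ M (λ x → x ≺ n ⇒ Y x)

      restrict : (n : Tm ℤ) → Tm (Partial (S n)) → Tm (Partial n)
      restrict n h x l = h x (≺-weaken x n l)

      module Extend (n : Tm ℤ) (h : Tm (Partial n)) =
        Cases (λ x → x ≺ S n ⇒ Y x) (λ w _ → a w) (λ x l → t x (h x (≺-pred x n l)))

      extend : (n : Tm ℤ) → Tm (Partial n) → Tm (Partial (S n))
      extend n h = Extend.cases n h

      -- By cases on the argument: on `base` both sides are `a w`; on `next` both call `h` on the
      -- predecessor, with proofs of `≺` that agree because it is a proposition.
      restrict-extend : (n : Tm ℤ) (h : Tm (Partial (S n))) →
        Tm (Id (Partial (S n)) (restrict (S n) (extend (S n) h)) (extend n (restrict n h)))
      restrict-extend n h = funext′ (λ x → x ≺ S n ⇒ Y x) (Cases.cases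
        (λ x → Id (x ≺ S n ⇒ Y x) (restrict (S n) (extend (S n) h) x) (extend n (restrict n h) x))
        (λ w → ap {base w ≺ S (S n) ⇒ Y (base w)} {base w ≺ S n ⇒ Y (base w)}
                 (λ k l → k (≺-weaken (base w) (S n) l)) (Extend.cases-base (S n) h w)
             ∙ sym (Extend.cases-base n (restrict n h) w))
        (λ x → ap {next x ≺ S (S n) ⇒ Y (next x)} {next x ≺ S n ⇒ Y (next x)}
                 (λ k l → k (≺-weaken (next x) (S n) l)) (Extend.cases-next (S n) h x)
             ∙ funext′ (λ _ → Y (next x)) (λ l →
                 ap {x ≺ S n} {Y (next x)} (λ l → t x (h x l)) (≺-prop x (S n) _ _))
             ∙ sym (Extend.cases-next n (restrict n h) x)))

      Solution : Tm ℤ → Ty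
      Solution n = Fix (Partial n) (restrict n ∘ extend n)

      isProp-Partial-0 : Tm (isProp (Partial 0ℤ))
      isProp-Partial-0 = isProp-∏ M (λ x → x ≺ 0ℤ ⇒ Y x) (λ x → isProp-∏ (x ≺ 0ℤ) (λ _ → Y x)
        (λ l y y′ → 𝟎-elim (Id (Y x) y y′) (≺-0 x l)))

      isContr-Solution : (n : Tm ℤ) → Tm (isContr (Solution n))
      isContr-Solution = ℤ-ind-prop (λ n → isContr (Solution n)) (λ n → isProp-isContr (Solution n))
        ( (empty , isProp-Partial-0 _ _)
        , λ _ → ∑-path-prop (λ h → Id (Partial 0ℤ) (restrict 0ℤ (extend 0ℤ h)) h)
                  (λ h → isProp⇒isSet (Partial 0ℤ) isProp-Partial-0 _ h) (isProp-Partial-0 _ _))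
        -- Rolling gives the fixed points of `extend n ∘ restrict n`, which `restrict-extend`
        -- identifies with the operator of stage `S n`. The next clause runs this backwards.
        (λ n c → isContr-Fix-cong (Partial (S n)) (extend n ∘ restrict n) (restrict (S n) ∘ extend (S n))
                   (restrict-extend n)
                   (isContr-Fix-roll (Partial n) (Partial (S n)) (extend n) (restrict n) c))
        (λ n c → isContr-Fix-roll (Partial (S n)) (Partial n) (restrict n) (extend n)
                   (isContr-Fix-cong (Partial (S n)) (restrict (S n) ∘ extend (S n)) (extend n ∘ restrict n)
                     (λ h → sym (restrict-extend n h)) c))
        where
        empty : Tm (Partial 0ℤ)
        empty x l = 𝟎-elim (Y x) (≺-0 x l)

      solution : (n : Tm ℤ) → Tm (Partial n)
      solution n = proj₁ (proj₁ (isContr-Solution n))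

      solution-unfold : (n : Tm ℤ) (x : Tm M) (l : Tm (x ≺ n)) →
        Tm (Id (Y x) (solution n x l) (extend n (solution n) x (≺-weaken x n l)))
      solution-unfold n x l =
        apply (λ _ → Y x) (apply (λ x → x ≺ n ⇒ Y x) (sym (proj₂ (proj₁ (isContr-Solution n)))) x) l

      -- The restriction is itself a solution at stage `n`, where solutions are unique.
      restrict-solution : (n : Tm ℤ) → Tm (Id (Partial n) (restrict n (solution (S n))) (solution n))
      restrict-solution n =
        ap {Solution n} {Partial n} proj₁ (isContr⇒isProp (Solution n) (isContr-Solution n)
          ( restrict n (solution (S n))
          , ap {Partial (S n)} {Partial n} (restrict n)
              (sym (restrict-extend n (solution (S n))) ∙ proj₂ (proj₁ (isContr-Solution (S n)))))
          (proj₁ (isContr-Solution n)))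

      ind : (x : Tm M) → Tm (Y x)
      ind x = solution (proj₁ x) x (≺-self x)

      ind-base : (w : Tm W) → Tm (Id (Y (base w)) (ind (base w)) (a w))
      ind-base w@(n , _) =
        solution-unfold (S n) (base w) (≺-self (base w))
        ∙ apply (λ _ → Y (base w)) (Extend.cases-base (S n) (solution (S n)) w) _

      ind-next : (x : Tm M) → Tm (Id (Y (next x)) (ind (next x)) (t x (ind x)))
      ind-next x@(n , _) =
        solution-unfold (S n) (next x) (≺-self (next x))
        ∙ apply (λ _ → Y (next x)) (Extend.cases-next (S n) (solution (S n)) x) _
        ∙ ap {Y x} {Y (next x)} (t x)
            -- The recursive call is made at stage `S n`, while `ind x` uses stage `n`;
            -- `restrict-solution` reconciles them.
            (ap {x ≺ S n} {Y x} (solution (S n) x) (≺-prop x (S n) _ _)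
            ∙ apply (λ _ → Y x) (apply (λ x → x ≺ n ⇒ Y x) (restrict-solution n) x) (≺-self x))

    module Root = M-Induction (λ _ → W) id (λ _ w → w)
    open Root using () renaming (ind to root; ind-base to root-base; ind-next to root-next)

    -- The fiber of `root` over `w₀`. `W` is not shown to be a set, so the path is genuine data that
    -- the induction below must track.
    ℕ : Ty
    ℕ = ∑ M (λ x → Id W w₀ (root x))

    zero : Tm ℕ
    zero = base w₀ , sym (root-base w₀)

    suc : Tm ℕ → Tm ℕ
    suc (x , p) = next x , p ∙ sym (root-next x)

    module ℕ-Induction (Y : Tm ℕ → Ty) (y₀ : Tm (Y zero)) (t : (n : Tm ℕ) → Tm (Y n) → Tm (Y (suc n))) where
      private
        Roots : Ty
        Roots = ∑ W (λ w → Id W w₀ (root (base w)))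

        -- Composition with `root-base` makes this a retract of the singleton at `w₀`, so `y₀` fixes
        -- the values at all bases in `ℕ`.
        isContr-Roots : Tm (isContr Roots)
        isContr-Roots = isContr-retract (∑ W (Id W w₀)) Roots
          (λ (w , p) → w , p ∙ sym (root-base w))
          (λ (w , p) → w , p ∙ root-base w)
          (λ (w , p) → ap {Id W w₀ (root (base w))} {Roots} (λ q → w , q)
                         (trans-cancelʳ-sym p (root-base w)))
          (isContr-singleton W w₀)

        Fiber : Tm M → Ty
        Fiber x = ∏ (Id W w₀ (root x)) (λ p → Y (x , p))

        at-base : Σ ((r : Tm Roots) → Tm (Y (base (proj₁ r) , proj₂ r))) λ h →
                  Tm (Id (Y zero) (h (w₀ , sym (root-base w₀))) y₀)
        at-base = isContr-ind Roots isContr-Roots (w₀ , sym (root-base w₀))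
                    (λ (w , p) → Y (base w , p)) y₀

        -- Composition with a path is an equivalence, so every path from `w₀` to `root (next x)`
        -- comes from one to `root x`.
        at-next : (x : Tm M) (h : Tm (Fiber x)) → Σ (Tm (Fiber (next x))) λ k →
                  (p : Tm (Id W w₀ (root x))) →
                  Tm (Id (Y (suc (x , p))) (k (p ∙ sym (root-next x))) (t (x , p) (h p)))
        at-next x h =
          isEquiv-ind (Id W w₀ (root x)) (Id W w₀ (root (next x))) (λ p → p ∙ sym (root-next x))
            (isEquiv-transʳ (sym (root-next x))) (λ p → Y (next x , p)) (λ p → t (x , p) (h p))

        module I = M-Induction Fiber (λ w p → proj₁ at-base (w , p)) (λ x h → proj₁ (at-next x h))

      ℕ-ind : (n : Tm ℕ) → Tm (Y n)
      ℕ-ind (x , p) = I.ind x p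

      ℕ-ind-zero : Tm (Id (Y zero) (ℕ-ind zero) y₀)
      ℕ-ind-zero = apply (λ p → Y (base w₀ , p)) (I.ind-base w₀) (sym (root-base w₀)) ∙ proj₂ at-base

      ℕ-ind-suc : (n : Tm ℕ) → Tm (Id (Y (suc n)) (ℕ-ind (suc n)) (t n (ℕ-ind n)))
      ℕ-ind-suc (x , p) =
        apply (λ p → Y (next x , p)) (I.ind-next x) (p ∙ sym (root-next x)) ∙ proj₂ (at-next x (I.ind x)) p

    ℕ-algebra : NatAlgebra
    ℕ-algebra = record { Carrier = ℕ ; z = zero ; s = suc }

    ℕ-induction : Induction ℕ-algebra
    ℕ-induction Y y₀ t = ℕ-ind , ℕ-ind-zero , ℕ-ind-suc
      where open ℕ-Induction Y y₀ t

mainTheorem1 : ∀ {ℓ ℓ′ : Level} (T : TypeTheory ℓ ℓ′) → IntegerType T → NaturalNumberType T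
mainTheorem1 T 𝕫 = record
  { algebra = ℕ-algebra
  ; initial = λ B → induction⇒isContr-Morphism ℕ-algebra B ℕ-induction
  }
  where
  open TwoElements T
  open Initiality T
  open Hotel T 𝕫
  open FreeAlgebra T 𝕫
  -- The gate has tag `𝟎₂`, so `¬isOne-0` itself places it outside `R`.
  open Crossing ℤ² hotel hotel⁻¹ hotel-η hotel-ε R
    (λ (_ , i) → isProp-IsOne i) (λ (_ , i) → IsOne-cases i) hotel-R gate ¬isOne-0 hotel-gate-R
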